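{- There exists $\epsilon>0$ such that for every positive integer $n$, every 2-increasing sequence of triples with all coordinates in $[n]=\{1,\dots,n\}$ has length at most $n^{2-\epsilon}$.
   Context: For integer triples $a=(a_1,a_2,a_3)$ and $b=(b_1,b_2,b_3)$, write $a<_2b$ ("$a$ is 2-less than $b$") if $a_i<b_i$ for at least two indices $i\in\{1,2,3\}$. A sequence $a^1,\dots,a^m$ of triples is 2-increasing if $a^i<_2a^j$ whenever $i<j$. -}

module Defs where

open import Data.Nat using (ℕ; _<_; _≤_)
open import Data.Fin using (Fin) renaming (_<_ to _<ᶠ_)
open import Data.Product using (_×_; _,_)
open import Data.Sum using (_⊎_)

Triple : Set
Triple = ℕ × ℕ × ℕ

_<₂_ : Triple → Triple → Set
(a₁ , a₂ , a₃) <₂ (b₁ , b₂ , b₃) =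
  (a₁ < b₁ × a₂ < b₂) ⊎ (a₁ < b₁ × a₃ < b₃) ⊎ (a₂ < b₂ × a₃ < b₃)

TwoIncreasing : {m : ℕ} → (Fin m → Triple) → Set
TwoIncreasing {m} a = (i j : Fin m) → i <ᶠ j → a i <₂ a j

InBox : ℕ → Triple → Set
InBox n (x , y , z) = (1 ≤ x × x ≤ n) × (1 ≤ y × y ≤ n) × (1 ≤ z × z ≤ n)

{-# OPTIONS --safe #-}
-- A 2-increasing sequence has no cycle r < i < q < r.  Call a K-adic block of
-- z-values full for a row (fixed y) if all K of its children contain a z-value of
-- that row, and likewise for blocks of y-values and levels (fixed z).  A block that
-- is not full loses a child, so only n^(2-δ) points meet many non-full blocks.
-- In a column (fixed x) consider a K-adic rectangle of (y,z)-values and let lo and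
-- hi be its first and last points with full blocks.  A point i whose z-block is well
-- above that of lo and whose y-block is well below that of hi would give r on the row
-- of hi with z strictly between lo and i, and q on the level of lo with y strictly
-- between i and hi, which is such a cycle.  Hence only four of the K y-children and
-- K z-children matter, and a column has few points meeting mostly full blocks.
module Submission where

open import Defs
open import Data.Nat using (ℕ; _<_; _≤_; _*_; _^_)
open import Data.Fin using (Fin)
open import Data.Product using (_×_; ∃-syntax)

open import Data.Nat using (zero; suc; pred; _+_; _∸_; _/_; NonZero; z≤n; s≤s; _≟_; _≤?_; _<?_; >-nonZero; >-nonZero⁻¹)
open import Data.Nat.Properties hiding (_≟_; _≤?_; _<?_; <-cmp)
open import Data.Nat.DivMod using (m≡m%n+[m/n]*n; m%n<n; m<n*o⇒m/o<n; /-monoˡ-≤)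
open import Data.Nat.Solver using (module +-*-Solver)
open import Data.Nat.Tactic.RingSolver using (solve-∀)
open import Data.Fin using (zero; suc; toℕ; fromℕ<; punchIn; punchOut; combine) renaming (_<_ to _<ᶠ_; _≤_ to _≤ᶠ_)
open import Data.Fin.Properties using (any?; all?; ¬∀⟶∃¬; toℕ-fromℕ<; fromℕ<-injective; combine-injective; punchIn-punchOut; punchOut-injective; injective⇒≤; <-cmp)
open import Data.Product using (_,_; proj₁; proj₂)
open import Data.Sum using (_⊎_; inj₁; inj₂)
open import Data.Empty using (⊥; ⊥-elim)
open import Data.Unit using (⊤; tt)
open import Data.List using (List; []; _∷_; map; length; allFin; upTo)
open import Data.Nat.ListAction using (sum)
open import Data.List.Properties using (length-map; length-tabulate; length-upTo)
open import Data.List.Membership.Propositional using (_∈_)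
open import Data.List.Membership.Propositional.Properties using (∈-map⁺; ∈-allFin; ∈-upTo⁺)
open import Data.List.Relation.Unary.Any using (here; there)
open import Data.List.Relation.Unary.All as All using (All; []; _∷_)
open import Data.List.Relation.Unary.AllPairs using (AllPairs; []; _∷_)
open import Data.List.Relation.Unary.AllPairs.Properties using (tabulate⁺-<)
open import Relation.Nullary using (¬_; Dec; yes; no; contradiction)
open import Relation.Nullary.Decidable using (_×-dec_)
open import Relation.Binary using (tri<; tri≈; tri>)
open import Relation.Binary.PropositionalEquality using (_≡_; _≢_; refl; sym; trans; cong; cong₂; subst; module ≡-Reasoning)

open +-*-Solver using (solve; _:*_; _:^_; _:=_)

-- Weighted counting over sorted lists of indices

module Weights {m : ℕ} where

  total : (Fin m → ℕ) → List (Fin m) → ℕ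
  total w xs = sum (map w xs)

  Sorted : List (Fin m) → Set
  Sorted = AllPairs _<ᶠ_

  -- The total weight of the indices satisfying P is at most B, phrased through
  -- lists so that P need not be decidable.
  Bounded : (Fin m → Set) → (Fin m → ℕ) → ℕ → Set
  Bounded P w B = ∀ xs → Sorted xs → All P xs → total w xs ≤ B

  private variable
    P Q R : Fin m → Set
    w w′ : Fin m → ℕ
    B C : ℕ

  bounded-⊆ : (∀ i → P i → Q i) → B ≤ C → Bounded Q w B → Bounded P w C
  bounded-⊆ P⊆Q B≤C bound xs s ps = ≤-trans (bound xs s (All.map (λ {i} → P⊆Q i) ps)) B≤C

  -- The last component strengthens the induction: every lower bound of `xs` passes to both parts,
  -- so that prepending `x` keeps them sorted.
  split : ∀ w xs → Sorted xs → All (λ i → P i ⊎ Q i) xs →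
          ∃[ ys ] ∃[ zs ] (Sorted ys × Sorted zs × All P ys × All Q zs ×
            total w xs ≡ total w ys + total w zs ×
            (∀ j → All (j <ᶠ_) xs → All (j <ᶠ_) ys × All (j <ᶠ_) zs))
  split w [] [] [] = [] , [] , [] , [] , [] , [] , refl , λ _ _ → [] , []
  split w (x ∷ xs) (x< ∷ s) (p ∷ ps) with split w xs s ps
  split w (x ∷ xs) (x< ∷ s) (inj₁ p ∷ ps) | ys , zs , sy , sz , py , qz , eq , lower =
    x ∷ ys , zs , proj₁ (lower x x<) ∷ sy , sz , p ∷ py , qz ,
    trans (cong (w x +_) eq) (sym (+-assoc (w x) _ _)) ,
    λ { j (j<x ∷ j<) → j<x ∷ proj₁ (lower j j<) , proj₂ (lower j j<) }
  split w (x ∷ xs) (x< ∷ s) (inj₂ q ∷ ps) | ys , zs , sy , sz , py , qz , eq , lower =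
    ys , x ∷ zs , sy , proj₂ (lower x x<) ∷ sz , py , q ∷ qz ,
    trans (cong (w x +_) eq) (swap (w x) (total w ys) (total w zs)) ,
    λ { j (j<x ∷ j<) → proj₁ (lower j j<) , j<x ∷ proj₂ (lower j j<) }
    where
    swap : ∀ a b c → a + (b + c) ≡ b + (a + c)
    swap = solve-∀

  bounded-⊎ : (∀ i → P i → Q i ⊎ R i) → Bounded Q w B → Bounded R w C → Bounded P w (B + C)
  bounded-⊎ {w = w} cover boundQ boundR xs s ps
    with split w xs s (All.map (λ {i} → cover i) ps)
  ... | ys , zs , sy , sz , qs , rs , eq , _ =
    ≤-trans (≤-reflexive eq) (+-mono-≤ (boundQ ys sy qs) (boundR zs sz rs))

  bounded-fibres : (h : Fin m → ℕ) (D : List ℕ) →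
    (∀ e → Bounded (λ i → P i × h i ≡ e) w B) →
    Bounded (λ i → P i × h i ∈ D) w (length D * B)
  bounded-fibres h [] bound [] _ _ = z≤n
  bounded-fibres h [] bound (_ ∷ _) _ ((_ , ()) ∷ _)
  bounded-fibres h (e ∷ D) bound = bounded-⊎
    (λ { i (p , here eq) → inj₁ (p , eq) ; i (p , there h∈D) → inj₂ (p , h∈D) })
    (bound e) (bounded-fibres h D bound)

  bounded-scale : ∀ c → (∀ i → P i → w i ≡ c * w′ i) → Bounded P w′ B → Bounded P w (c * B)
  bounded-scale {w = w} {w′ = w′} c w≡ bound xs s ps =
    ≤-trans (≤-reflexive (go xs ps)) (*-monoʳ-≤ c (bound xs s ps))
    where
    go : ∀ xs → All _ xs → total w xs ≡ c * total w′ xs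
    go [] [] = sym (*-zeroʳ c)
    go (x ∷ xs) (p ∷ ps) =
      trans (cong₂ _+_ (w≡ x p) (go xs ps)) (sym (*-distribˡ-+ c (w′ x) (total w′ xs)))

  bounded-≤1 : (∀ i j → i <ᶠ j → P i → P j → ⊥) → (∀ i → P i → w i ≤ B) → Bounded P w B
  bounded-≤1 sub w≤B [] _ _ = z≤n
  bounded-≤1 {w = w} sub w≤B (x ∷ []) _ (p ∷ []) = ≤-trans (≤-reflexive (+-identityʳ (w x))) (w≤B x p)
  bounded-≤1 sub w≤B (x ∷ y ∷ _) ((x<y ∷ _) ∷ _) (p ∷ q ∷ _) = ⊥-elim (sub x y x<y p q)

  last : ∀ x xs → Sorted (x ∷ xs) → All P (x ∷ xs) →
         ∃[ l ] (P l × x ≤ᶠ l × All (_≤ᶠ l) xs)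
  last x [] _ (p ∷ []) = x , p , ≤-refl , []
  last x (y ∷ ys) ((x<y ∷ _) ∷ s) (_ ∷ ps) with last y ys s ps
  ... | l , pl , y≤l , ys≤l = l , pl , ≤-trans (<⇒≤ x<y) y≤l , y≤l ∷ ys≤l

  -- Every nonempty list lies between its own first and last entries, and these serve as `lo` and
  -- `hi`.
  bounded-between : (∀ lo hi → P lo → P hi → Bounded (λ i → P i × lo ≤ᶠ i × i ≤ᶠ hi) w B) →
                    Bounded P w B
  bounded-between bound [] _ _ = z≤n
  bounded-between bound (x ∷ xs) s@(x< ∷ _) ps@(p ∷ ps′) with last x xs s ps
  ... | l , pl , x≤l , xs≤l =
    bound x l p pl (x ∷ xs) s
      ((p , ≤-refl , x≤l) ∷ All.zipWith (λ (pi , x<i , i≤l) → pi , <⇒≤ x<i , i≤l)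
                              (ps′ , All.zip (x< , xs≤l)))

  one : Fin m → ℕ
  one _ = 1

  -- Markov's inequality: it turns a bound on total weight into a bound on the number of heavy
  -- points.
  bounded-count : ∀ c .{{_ : NonZero c}} → (∀ i → P i → c ≤ w i) → Bounded P w B → B ≤ c * C →
                  Bounded P one C
  bounded-count {w = w} c c≤w bound B≤ xs s ps =
    *-cancelˡ-≤ c (≤-trans (go xs ps) (≤-trans (bound xs s ps) B≤))
    where
    go : ∀ xs → All _ xs → c * total one xs ≤ total w xs
    go [] [] = ≤-reflexive (*-zeroʳ c)
    go (x ∷ xs) (p ∷ ps) = ≤-trans (≤-reflexive (*-suc c (total one xs))) (+-mono-≤ (c≤w x p) (go xs ps))

  bounded-all : Bounded (λ _ → ⊤) one B → m ≤ B
  bounded-all {B = B} bound = subst (_≤ B) total-one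
    (bound (allFin m) (tabulate⁺-< (λ i<j → i<j)) (All.universal (λ _ → tt) (allFin m)))
    where
    count : ∀ xs → total one xs ≡ length xs
    count [] = refl
    count (_ ∷ xs) = cong suc (count xs)
    total-one : total one (allFin m) ≡ m
    total-one = trans (count (allFin m)) (length-tabulate (λ i → i))
open Weights

-- Arithmetic of powers, indicators and neighbouring values

*-swap : ∀ p q r → p * (q * r) ≡ q * (p * r)
*-swap = solve-∀

^-distribʳ-* : ∀ p q s → (p * q) ^ s ≡ p ^ s * q ^ s
^-distribʳ-* p q zero = refl
^-distribʳ-* p q (suc s) = trans (cong (p * q *_) (^-distribʳ-* p q s)) (interchange p q (p ^ s) (q ^ s))
  where
  interchange : ∀ a b c d → a * b * (c * d) ≡ a * c * (b * d)
  interchange = solve-∀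

-- The number of factors is the same on both sides; `p - s` of them are raised from `k` to `K`.
^-trade : ∀ {k K} → k ≤ K → ∀ {s r p q} → s ≤ p → p + q ≡ s + r → K ^ s * k ^ r ≤ K ^ p * k ^ q
^-trade {k} {K} k≤K {s} {r} {p} {q} s≤p p+q≡s+r
  with d , refl ← m≤n⇒∃[o]m+o≡n s≤p
  with refl ← +-cancelˡ-≡ s _ _ (trans (sym (+-assoc s d q)) p+q≡s+r) = begin
    K ^ s * k ^ (d + q)       ≡⟨ cong (K ^ s *_) (^-distribˡ-+-* k d q) ⟩
    K ^ s * (k ^ d * k ^ q)   ≡⟨ *-assoc (K ^ s) (k ^ d) (k ^ q) ⟨
    K ^ s * k ^ d * k ^ q     ≤⟨ *-monoˡ-≤ (k ^ q) (*-monoʳ-≤ (K ^ s) (^-monoˡ-≤ d k≤K)) ⟩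
    K ^ s * K ^ d * k ^ q     ≡⟨ cong (_* k ^ q) (^-distribˡ-+-* K s d) ⟨
    K ^ (s + d) * k ^ q       ∎
  where open ≤-Reasoning

indicator : {A : Set} → Dec A → ℕ
indicator (yes _) = 1
indicator (no _) = 0

indicator-yes : {A : Set} (d : Dec A) → A → indicator d ≡ 1
indicator-yes (yes _) _ = refl
indicator-yes (no ¬a) a = contradiction a ¬a

indicator-no : {A : Set} (d : Dec A) → ¬ A → indicator d ≡ 0
indicator-no (yes a) ¬a = contradiction a ¬a
indicator-no (no _) _ = refl

indicator-complement : {A : Set} (d : Dec A) → (1 ∸ indicator d) + indicator d ≡ 1
indicator-complement (yes _) = refl
indicator-complement (no _) = refl

∈-above : ∀ {e t} → e ≤ t → t ≤ suc e → t ∈ (e ∷ suc e ∷ [])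
∈-above e≤t t≤ with m≤n⇒m<n∨m≡n e≤t
... | inj₁ e<t = there (here (≤-antisym t≤ e<t))
... | inj₂ e≡t = here (sym e≡t)

∈-below : ∀ {e t} → t ≤ e → e ≤ suc t → t ∈ (e ∷ pred e ∷ [])
∈-below t≤e e≤ with m≤n⇒m<n∨m≡n t≤e
... | inj₁ t<e = there (here (cong pred (≤-antisym t<e e≤)))
... | inj₂ t≡e = here t≡e

-- K-adic blocks and the scarcity of points with many non-full blocks

module Blocks (k : ℕ) where

  K : ℕ
  K = suc k

  -- This is the quotient of `v` by `K ^ b`, taken by repeated division so that the parent of a
  -- block is by definition its quotient by `K`.
  block : ℕ → ℕ → ℕ
  block zero v = v
  block (suc b) v = block b v / K

  block-mono : ∀ b {u v} → u ≤ v → block b u ≤ block b v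
  block-mono zero u≤v = u≤v
  block-mono (suc b) u≤v = /-monoˡ-≤ K (block-mono b u≤v)

  block-cancel-< : ∀ b {u v} → block b u < block b v → u < v
  block-cancel-< b {u} {v} lt with u <? v
  ... | yes u<v = u<v
  ... | no u≮v = contradiction (block-mono b (≮⇒≥ u≮v)) (<⇒≱ lt)

  block-< : ∀ b c {v} → v < c * K ^ b → block b v < c
  block-< zero c v< = subst (_ <_) (*-identityʳ c) v<
  block-< (suc b) c {v} v< = m<n*o⇒m/o<n {n = c} (block-< b (c * K) (subst (v <_) (sym (*-assoc c K (K ^ b))) v<))

  block-top : ∀ b {v} → v < K ^ b → block b v ≡ 0
  block-top b v< = n<1⇒n≡0 (block-< b 1 (subst (_ <_) (sym (*-identityˡ (K ^ b))) v<))

  -- Division by `K` is monotone and `suc s` lies between two siblings. This supplies a child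
  -- strictly between them.
  suc-same-parent : ∀ {s t} → s / K ≡ t / K → suc s < t → suc s / K ≡ s / K
  suc-same-parent eq lt =
    ≤-antisym (≤-trans (/-monoˡ-≤ K (<⇒≤ lt)) (≤-reflexive (sym eq))) (/-monoˡ-≤ K (n≤1+n _))

  child : ℕ → Fin K → ℕ
  child c d = toℕ d + c * K

  digit : ℕ → Fin K
  digit e = fromℕ< (m%n<n e K)

  child-digit : ∀ {e c} → e / K ≡ c → e ≡ child c (digit e)
  child-digit {e} refl = trans (m≡m%n+[m/n]*n e K) (cong (_+ e / K * K) (sym (toℕ-fromℕ< (m%n<n e K))))

  children : ℕ → List ℕ
  children c = map (child c) (allFin K)

  length-children : ∀ c → length (children c) ≡ K
  length-children c = trans (length-map (child c) (allFin K)) (length-tabulate {n = K} (λ i → i))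

  ∈-children : ∀ {e c} → e / K ≡ c → e ∈ children c
  ∈-children {e} {c} eq = subst (_∈ children c) (sym (child-digit eq)) (∈-map⁺ (child c) (∈-allFin (digit e)))

  siblings : ℕ → Fin K → List ℕ
  siblings c d = map (λ d′ → child c (punchIn d d′)) (allFin k)

  length-siblings : ∀ c d → length (siblings c d) ≡ k
  length-siblings c d = trans (length-map (λ d′ → child c (punchIn d d′)) (allFin k)) (length-tabulate {n = k} (λ i → i))

  ∈-siblings : ∀ {e c} d → e / K ≡ c → e ≢ child c d → e ∈ siblings c d
  ∈-siblings {e} {c} d eq e≢ = subst (_∈ siblings c d)
    (trans (cong (child c) (punchIn-punchOut d≢)) (sym (child-digit eq)))
    (∈-map⁺ (λ d′ → child c (punchIn d d′)) (∈-allFin (punchOut d≢)))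
    where
    d≢ : d ≢ digit e
    d≢ refl = e≢ (child-digit eq)

  -- Here `f` tells on which line a point lies and `g` its position on that line, so that rows and
  -- levels are treated alike.
  module Tree {m : ℕ} (f g : Fin m → ℕ) (separated : ∀ i j → i <ᶠ j → f i ≡ f j → g i ≢ g j) where

    Hit : ℕ → ℕ → ℕ → Set
    Hit b v e = ∃[ j ] (f j ≡ v × block b (g j) ≡ e)

    hit? : ∀ b v e → Dec (Hit b v e)
    hit? b v e = any? (λ j → (f j ≟ v) ×-dec (block b (g j) ≟ e))

    -- The index `b` is the level of the children; the block `c` itself has level `suc b`.
    Full : ℕ → ℕ → ℕ → Set
    Full b v c = ∀ d → Hit b v (child c d)

    full? : ∀ b v c → Dec (Full b v c)
    full? b v c = all? (λ d → hit? b v (child c d))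

    full-hit : ∀ b {v c e} → Full b v c → e / K ≡ c → Hit b v e
    full-hit b {v} {e = e} full eq = subst (Hit b v) (sym (child-digit eq)) (full (digit e))

    FullAt : ℕ → Fin m → Set
    FullAt b i = Full b (f i) (block (suc b) (g i))

    fullAt? : ∀ b i → Dec (FullAt b i)
    fullAt? b i = full? b (f i) (block (suc b) (g i))

    good bad : ℕ → Fin m → ℕ
    good zero i = 0
    good (suc b) i = indicator (fullAt? b i) + good b i
    bad zero i = 0
    bad (suc b) i = (1 ∸ indicator (fullAt? b i)) + bad b i

    good-full : ∀ b i → FullAt b i → good (suc b) i ≡ suc (good b i)
    good-full b i full = cong (_+ good b i) (indicator-yes (fullAt? b i) full)

    good-notFull : ∀ b i → ¬ FullAt b i → good (suc b) i ≡ good b i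
    good-notFull b i ¬full = cong (_+ good b i) (indicator-no (fullAt? b i) ¬full)

    bad-full : ∀ b i → FullAt b i → bad (suc b) i ≡ bad b i
    bad-full b i full = cong (λ t → (1 ∸ t) + bad b i) (indicator-yes (fullAt? b i) full)

    bad-notFull : ∀ b i → ¬ FullAt b i → bad (suc b) i ≡ suc (bad b i)
    bad-notFull b i ¬full = cong (λ t → (1 ∸ t) + bad b i) (indicator-no (fullAt? b i) ¬full)

    bad+good : ∀ b i → bad b i + good b i ≡ b
    bad+good zero i = refl
    bad+good (suc b) i = trans (interchange (1 ∸ t) (bad b i) t (good b i))
      (cong₂ _+_ (indicator-complement (fullAt? b i)) (bad+good b i))
      where
      t = indicator (fullAt? b i)
      interchange : ∀ p q r s → (p + q) + (r + s) ≡ (p + r) + (q + s)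
      interchange = solve-∀

    good≤ : ∀ b i → good b i ≤ b
    good≤ b i = subst (good b i ≤_) (bad+good b i) (m≤n+m (good b i) (bad b i))

    -- Points with many non-full blocks are the heavy ones, so a bound on the total weight makes
    -- them rare.
    weight : ℕ → Fin m → ℕ
    weight b i = K ^ bad b i * k ^ good b i

    weight-full : ∀ b i → FullAt b i → weight (suc b) i ≡ k * weight b i
    weight-full b i full = trans
      (cong₂ (λ s t → K ^ s * k ^ t) (bad-full b i full) (good-full b i full))
      (*-swap (K ^ bad b i) k (k ^ good b i))

    weight-notFull : ∀ b i → ¬ FullAt b i → weight (suc b) i ≡ K * weight b i
    weight-notFull b i ¬full = trans
      (cong₂ (λ s t → K ^ s * k ^ t) (bad-notFull b i ¬full) (good-notFull b i ¬full))
      (*-assoc K (K ^ bad b i) (k ^ good b i))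

    -- A non-full block has at most k occupied children, a full one gets the
    -- smaller factor k; either way a level contributes K * k.
    fibre-bound : ∀ b v c → Bounded (λ i → f i ≡ v × block b (g i) ≡ c) (weight b) ((K * k) ^ b)
    fibre-bound zero v c = bounded-≤1
      (λ { i j i<j (fi , gi) (fj , gj) → separated i j i<j (trans fi (sym fj)) (trans gi (sym gj)) })
      (λ _ _ → ≤-refl)
    fibre-bound (suc b) v c with full? b v c
    ... | yes full = bounded-⊆ (λ _ p → p) (≤-reflexive (reorder k K ((K * k) ^ b)))
          (bounded-scale k (λ { i (refl , refl) → weight-full b i full })
            (bounded-⊆ (λ { i (fi , gi) → fi , ∈-children gi })
              (≤-reflexive (cong (_* (K * k) ^ b) (length-children c)))
              (bounded-fibres (λ i → block b (g i)) (children c) (λ e → fibre-bound b v e))))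
      where
      reorder : ∀ p q r → p * (q * r) ≡ q * p * r
      reorder = solve-∀
    ... | no ¬full with ¬∀⟶∃¬ K _ (λ d → hit? b v (child c d)) ¬full
    ...   | d , ¬hit = bounded-⊆ (λ _ p → p) (≤-reflexive (sym (*-assoc K k ((K * k) ^ b))))
          (bounded-scale K (λ { i (refl , refl) → weight-notFull b i ¬full })
            (bounded-⊆ (λ { i (fi , gi) → fi , ∈-siblings d gi (λ eq → ¬hit (i , fi , eq)) })
              (≤-reflexive (cong (_* (K * k) ^ b) (length-siblings c d)))
              (bounded-fibres (λ i → block b (g i)) (siblings c d) (λ e → fibre-bound b v e))))

    -- The `K ^ (T * 4)` lines together weigh at most `K ^ (T * 4) * (K * k) ^ (T * 4)`. A point
    -- with at least a quarter of its levels non-full weighs at least `K ^ T * k ^ (T * 3)`, and the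
    -- quotient is the stated bound.
    bad-count : .{{_ : NonZero k}} → ∀ T →
      (∀ i → f i < K ^ (T * 4)) → (∀ i → g i < K ^ (T * 4)) →
      Bounded (λ i → T ≤ bad (T * 4) i) one ((K ^ T) ^ 7 * k ^ T)
    bad-count T f< g< = bounded-count (K ^ T * k ^ (T * 3))
      {{m*n≢0 (K ^ T) (k ^ (T * 3)) {{m^n≢0 K T}} {{m^n≢0 k (T * 3)}}}}
      (λ i T≤bad → ^-trade (n≤1+n k) T≤bad (trans (bad+good (T * 4) i) (*-suc T 3)))
      (bounded-⊆ (λ i _ → block-top (T * 4) (g< i) , ∈-upTo⁺ (f< i))
        (≤-reflexive (cong (_* (K * k) ^ (T * 4)) (length-upTo (K ^ (T * 4)))))
        (bounded-fibres f (upTo (K ^ (T * 4)))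
          (λ e → bounded-⊆ (λ { i (gi , fi) → fi , gi }) ≤-refl (fibre-bound (T * 4) e 0))))
      (≤-reflexive (begin
        K ^ (T * 4) * (K * k) ^ (T * 4)
          ≡⟨ cong (K ^ (T * 4) *_) (^-distribʳ-* K k (T * 4)) ⟩
        K ^ (T * 4) * (K ^ (T * 4) * k ^ (T * 4))
          ≡⟨ cong₂ (λ p q → p * (p * q)) (sym (^-*-assoc K T 4)) (sym (^-*-assoc k T 4)) ⟩
        (K ^ T) ^ 4 * ((K ^ T) ^ 4 * (k ^ T) ^ 4)
          ≡⟨ powers (K ^ T) (k ^ T) ⟩
        K ^ T * (k ^ T) ^ 3 * ((K ^ T) ^ 7 * k ^ T)
          ≡⟨ cong (λ q → K ^ T * q * ((K ^ T) ^ 7 * k ^ T)) (^-*-assoc k T 3) ⟩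
        K ^ T * k ^ (T * 3) * ((K ^ T) ^ 7 * k ^ T) ∎))
      where
      open ≡-Reasoning
      powers : ∀ p q → p ^ 4 * (p ^ 4 * q ^ 4) ≡ p * q ^ 3 * (p ^ 7 * q)
      powers = solve 2 (λ p q → p :^ 4 :* (p :^ 4 :* q :^ 4) := p :* q :^ 3 :* (p :^ 7 :* q)) refl

-- Order relations forced by a 2-increasing sequence

module Order {m : ℕ} (a : Fin m → Triple) (inc : TwoIncreasing a) where

  x y z : Fin m → ℕ
  x i = proj₁ (a i)
  y i = proj₁ (proj₂ (a i))
  z i = proj₂ (proj₂ (a i))

  -- A tie in one coordinate leaves only the other two to increase; likewise for `same-y` and
  -- `same-z`.
  same-x : ∀ {i j} → i <ᶠ j → x i ≡ x j → y i < y j × z i < z j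
  same-x {i} {j} i<j eq with inc i j i<j
  ... | inj₁ (x< , _) = contradiction eq (<⇒≢ x<)
  ... | inj₂ (inj₁ (x< , _)) = contradiction eq (<⇒≢ x<)
  ... | inj₂ (inj₂ yz<) = yz<

  same-y : ∀ {i j} → i <ᶠ j → y i ≡ y j → x i < x j × z i < z j
  same-y {i} {j} i<j eq with inc i j i<j
  ... | inj₁ (_ , y<) = contradiction eq (<⇒≢ y<)
  ... | inj₂ (inj₁ xz<) = xz<
  ... | inj₂ (inj₂ (y< , _)) = contradiction eq (<⇒≢ y<)

  same-z : ∀ {i j} → i <ᶠ j → z i ≡ z j → x i < x j × y i < y j
  same-z {i} {j} i<j eq with inc i j i<j
  ... | inj₁ xy< = xy<
  ... | inj₂ (inj₁ (_ , z<)) = contradiction eq (<⇒≢ z<)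
  ... | inj₂ (inj₂ (_ , z<)) = contradiction eq (<⇒≢ z<)

  -- In the opposite order two coordinates would have to decrease from `i` to `j`, and any two of
  -- the three include x or y. The two variants below hold for the same reason.
  before-xy : ∀ {i j} → x i < x j → y i < y j → i <ᶠ j
  before-xy {i} {j} x< y< with <-cmp i j
  ... | tri< i<j _ _ = i<j
  ... | tri≈ _ refl _ = contradiction x< (<-irrefl refl)
  ... | tri> _ _ j<i with inc j i j<i
  ...   | inj₁ (x> , _) = contradiction x> (<-asym x<)
  ...   | inj₂ (inj₁ (x> , _)) = contradiction x> (<-asym x<)
  ...   | inj₂ (inj₂ (y> , _)) = contradiction y> (<-asym y<)

  before-xz : ∀ {i j} → x i < x j → z i < z j → i <ᶠ j
  before-xz {i} {j} x< z< with <-cmp i j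
  ... | tri< i<j _ _ = i<j
  ... | tri≈ _ refl _ = contradiction x< (<-irrefl refl)
  ... | tri> _ _ j<i with inc j i j<i
  ...   | inj₁ (x> , _) = contradiction x> (<-asym x<)
  ...   | inj₂ (inj₁ (x> , _)) = contradiction x> (<-asym x<)
  ...   | inj₂ (inj₂ (_ , z>)) = contradiction z> (<-asym z<)

  before-yz : ∀ {i j} → y i < y j → z i < z j → i <ᶠ j
  before-yz {i} {j} y< z< with <-cmp i j
  ... | tri< i<j _ _ = i<j
  ... | tri≈ _ refl _ = contradiction y< (<-irrefl refl)
  ... | tri> _ _ j<i with inc j i j<i
  ...   | inj₁ (_ , y>) = contradiction y> (<-asym y<)
  ...   | inj₂ (inj₁ (_ , z>)) = contradiction z> (<-asym z<)
  ...   | inj₂ (inj₂ (y> , _)) = contradiction y> (<-asym y<)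

  column-mono : ∀ {i j} → x i ≡ x j → i ≤ᶠ j → y i ≤ y j × z i ≤ z j
  column-mono {i} {j} eq i≤j with <-cmp i j
  ... | tri< i<j _ _ = <⇒≤ (proj₁ (same-x i<j eq)) , <⇒≤ (proj₂ (same-x i<j eq))
  ... | tri≈ _ refl _ = ≤-refl , ≤-refl
  ... | tri> _ _ j<i = contradiction i≤j (<⇒≱ j<i)

  row-x : ∀ {i j} → y i ≡ y j → z i < z j → x i < x j
  row-x {i} {j} eq z< with <-cmp i j
  ... | tri< i<j _ _ = proj₁ (same-y i<j eq)
  ... | tri≈ _ refl _ = contradiction z< (<-irrefl refl)
  ... | tri> _ _ j<i = contradiction (proj₂ (same-y j<i (sym eq))) (<-asym z<)

  level-x : ∀ {i j} → z i ≡ z j → y i < y j → x i < x j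
  level-x {i} {j} eq y< with <-cmp i j
  ... | tri< i<j _ _ = proj₁ (same-z i<j eq)
  ... | tri≈ _ refl _ = contradiction y< (<-irrefl refl)
  ... | tri> _ _ j<i = contradiction (proj₂ (same-z j<i (sym eq))) (<-asym y<)

  -- r precedes i and i precedes q, yet q lies below r in both y and z.
  no-cycle : ∀ {lo i hi r q} → x lo ≡ x i → x i ≡ x hi → y lo ≤ y i → z i ≤ z hi →
             y r ≡ y hi → z lo < z r → z r < z i →
             z q ≡ z lo → y i < y q → y q < y hi → ⊥
  no-cycle {lo} {i} {hi} {r} {q} xlo xhi ylo zhi yr zlo<zr zr<zi zq yi<yq yq<yhi =
    <-asym (<-trans r<i i<q) q<r
    where
    -- On the row of `hi` a smaller z means a smaller x, and `hi` shares its x with `i`. The next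
    -- step argues in the same way on the level of `lo`.
    r<i : r <ᶠ i
    r<i = before-xz (subst (x r <_) (sym xhi) (row-x yr (<-≤-trans zr<zi zhi))) zr<zi
    i<q : i <ᶠ q
    i<q = before-xy (subst (_< x q) xlo (level-x (sym zq) (≤-<-trans ylo yi<yq))) yi<yq
    q<r : q <ᶠ r
    q<r = before-yz (subst (y q <_) (sym yr) yq<yhi) (subst (_< z r) (sym zq) zlo<zr)

-- Counting the points of a column that meet mostly full blocks

module Columns (k : ℕ) {m : ℕ} (a : Fin m → Triple) (inc : TwoIncreasing a) where
  open Blocks k
  open Order a inc

  -- The suffix names the coordinate cut into blocks: `TZ` follows z along rows, `TY` follows y
  -- along levels.
  module TZ = Tree y z (λ i j i<j eq → <⇒≢ (proj₂ (same-y i<j eq)))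
  module TY = Tree z y (λ i j i<j eq → <⇒≢ (proj₂ (same-z i<j eq)))

  -- In contrast to `weight`, only full blocks earn a factor, so the heavy points are those left
  -- over by `bad-count`.
  goodness : ℕ → ℕ → Fin m → ℕ
  goodness b c i = K ^ TY.good b i * K ^ TZ.good c i

  InRectangle : ℕ → ℕ → ℕ → ℕ → ℕ → Fin m → Set
  InRectangle b c u v w i = x i ≡ u × block b (y i) ≡ v × block c (z i) ≡ w

  -- Otherwise the z-child after that of `lo` comes strictly before that of `i`, and the y-child
  -- after that of `i` strictly before that of `hi`. Fullness at `hi` puts a point `r` of its row
  -- into the former, fullness at `lo` a point `q` of its level into the latter, and these close the
  -- cycle.
  near : ∀ b c {u v w lo i hi} →
    InRectangle (suc b) (suc c) u v w lo → TY.FullAt b lo →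
    InRectangle (suc b) (suc c) u v w i →
    InRectangle (suc b) (suc c) u v w hi → TZ.FullAt c hi →
    lo ≤ᶠ i → i ≤ᶠ hi →
    block c (z i) ∈ (block c (z lo) ∷ suc (block c (z lo)) ∷ []) ⊎
    block b (y i) ∈ (block b (y hi) ∷ pred (block b (y hi)) ∷ [])
  near b c {lo = lo} {i} {hi} (xlo , ylo , zlo) fullLo (xi , yi , zi) (xhi , yhi , zhi) fullHi lo≤i i≤hi
    with lo-i ← column-mono (trans xlo (sym xi)) lo≤i | i-hi ← column-mono (trans xi (sym xhi)) i≤hi
    with block c (z i) ≤? suc (block c (z lo)) | block b (y hi) ≤? suc (block b (y i))
  ... | yes close | _ = inj₁ (∈-above (block-mono c (proj₂ lo-i)) close)
  ... | no _ | yes close = inj₂ (∈-below (block-mono b (proj₁ i-hi)) close)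
  ... | no farZ | no farY
      with TZ.full-hit c fullHi (trans (suc-same-parent (trans zlo (sym zi)) (≰⇒> farZ)) (trans zlo (sym zhi)))
         | TY.full-hit b fullLo (trans (suc-same-parent (trans yi (sym yhi)) (≰⇒> farY)) (trans yi (sym ylo)))
  ...   | r , yr , zr | q , zq , yq = ⊥-elim (no-cycle
          (trans xlo (sym xi)) (trans xi (sym xhi)) (proj₁ lo-i) (proj₂ i-hi)
          yr (block-cancel-< c (≤-reflexive (sym zr)))
             (block-cancel-< c (≤-<-trans (≤-reflexive zr) (≰⇒> farZ)))
          zq (block-cancel-< b (≤-reflexive (sym yq)))
             (block-cancel-< b (≤-<-trans (≤-reflexive yq) (≰⇒> farY))))

  goodness-splitʸ : ∀ b c i → TY.FullAt b i → goodness (suc b) c i ≡ K * goodness b c i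
  goodness-splitʸ b c i full =
    trans (cong (λ t → K ^ t * K ^ TZ.good c i) (TY.good-full b i full))
      (*-assoc K (K ^ TY.good b i) (K ^ TZ.good c i))

  goodness-splitᶻ : ∀ b c i → TZ.FullAt c i → goodness b (suc c) i ≡ K * goodness b c i
  goodness-splitᶻ b c i full =
    trans (cong (λ t → K ^ TY.good b i * K ^ t) (TZ.good-full c i full)) (*-swap (K ^ TY.good b i) K _)

  -- This serves the base cases of `rectangle-bound`, where a single y or z leaves at most one point
  -- of the column; the factor 6 is slack here.
  goodness-≤ : ∀ b c i → goodness b c i ≤ (6 * K) ^ (b + c)
  goodness-≤ b c i = begin
    K ^ TY.good b i * K ^ TZ.good c i ≤⟨ *-mono-≤ (^-monoʳ-≤ K (TY.good≤ b i)) (^-monoʳ-≤ K (TZ.good≤ c i)) ⟩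
    K ^ b * K ^ c                     ≡⟨ ^-distribˡ-+-* K b c ⟨
    K ^ (b + c)                       ≤⟨ ^-monoˡ-≤ (b + c) (m≤n*m K 6) ⟩
    (6 * K) ^ (b + c)                 ∎
    where open ≤-Reasoning

  -- Of the six summands, two come from the points at which y or z is not full
  -- (all K children), and four from the children singled out by `near`.
  rectangle-bound : ∀ b c u v w → Bounded (InRectangle b c u v w) (goodness b c) ((6 * K) ^ (b + c))
  rectangle-bound zero c u v w = bounded-≤1
    (λ { i j i<j (xi , yi , _) (xj , yj , _) →
         <⇒≢ (proj₁ (same-x i<j (trans xi (sym xj)))) (trans yi (sym yj)) })
    (λ i _ → goodness-≤ zero c i)
  rectangle-bound (suc b) zero u v w = bounded-≤1
    (λ { i j i<j (xi , _ , zi) (xj , _ , zj) →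
         <⇒≢ (proj₂ (same-x i<j (trans xi (sym xj)))) (trans zi (sym zj)) })
    (λ i _ → goodness-≤ (suc b) zero i)
  rectangle-bound (suc b) (suc c) u v w =
    bounded-⊆ (λ _ p → p) (≤-reflexive (collect K E))
      (bounded-⊎ cases notFullY (bounded-⊎ (λ _ p → p) notFullZ
        (bounded-between λ lo hi (plo , fullLo , _) (phi , _ , fullHi) →
          bounded-⊎ (λ { i ((p , fy , fz) , lo≤i , i≤hi) →
                         choose fy fz p (near b c plo fullLo p phi fullHi lo≤i i≤hi) })
            (nearLo (block c (z lo))) (nearHi (block b (y hi))))))
    where
    P : Fin m → Set
    P = InRectangle (suc b) (suc c) u v w

    E : ℕ
    E = (6 * K) ^ (b + suc c)

    collect : ∀ K E → K * E + (K * E + (K * (2 * E) + K * (2 * E))) ≡ 6 * K * E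
    collect = solve-∀

    cases : ∀ i → P i → (P i × ¬ TY.FullAt b i) ⊎ (P i × ¬ TZ.FullAt c i) ⊎ (P i × TY.FullAt b i × TZ.FullAt c i)
    cases i p with TY.fullAt? b i | TZ.fullAt? c i
    ... | no ¬fy | _ = inj₁ (p , ¬fy)
    ... | yes _ | no ¬fz = inj₂ (inj₁ (p , ¬fz))
    ... | yes fy | yes fz = inj₂ (inj₂ (p , fy , fz))

    -- Only one coordinate is subdivided at a time, so `b + c` drops by one and both recursive
    -- bounds equal `E`.
    shrinkʸ : ∀ D → Bounded (λ i → P i × block b (y i) ∈ D) (goodness b (suc c)) (length D * E)
    shrinkʸ D = bounded-fibres (λ i → block b (y i)) D
      (λ e → bounded-⊆ (λ { i ((xi , _ , zi) , yi) → xi , yi , zi }) ≤-refl (rectangle-bound b (suc c) u e w))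

    shrinkᶻ : ∀ D → Bounded (λ i → P i × block c (z i) ∈ D) (goodness (suc b) c) (length D * E)
    shrinkᶻ D = bounded-fibres (λ i → block c (z i)) D
      (λ e → bounded-⊆ (λ { i ((xi , yi , _) , zi) → xi , yi , zi })
               (≤-reflexive (cong ((6 * K) ^_) (sym (+-suc b c)))) (rectangle-bound (suc b) c u v e))

    notFullY : Bounded (λ i → P i × ¬ TY.FullAt b i) (goodness (suc b) (suc c)) (K * E)
    notFullY = bounded-⊆ (λ _ p → p) (≤-reflexive (*-identityˡ (K * E)))
      -- The goodness does not change at a non-full block, so passing to all `K` children costs a
      -- factor `K` and nothing more.
      (bounded-scale 1
        (λ { i (_ , ¬fy) → trans (cong (λ t → K ^ t * K ^ TZ.good (suc c) i) (TY.good-notFull b i ¬fy))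
                                 (sym (*-identityˡ _)) })
        (bounded-⊆ (λ { i (p@(_ , yi , _) , _) → p , ∈-children yi })
          (≤-reflexive (cong (_* E) (length-children v))) (shrinkʸ (children v))))

    notFullZ : Bounded (λ i → P i × ¬ TZ.FullAt c i) (goodness (suc b) (suc c)) (K * E)
    notFullZ = bounded-⊆ (λ _ p → p) (≤-reflexive (*-identityˡ (K * E)))
      (bounded-scale 1
        (λ { i (_ , ¬fz) → trans (cong (λ t → K ^ TY.good (suc b) i * K ^ t) (TZ.good-notFull c i ¬fz))
                                 (sym (*-identityˡ _)) })
        (bounded-⊆ (λ { i (p@(_ , _ , zi) , _) → p , ∈-children zi })
          (≤-reflexive (cong (_* E) (length-children w))) (shrinkᶻ (children w))))

    -- At a full block the goodness gains a factor `K`, but only two children remain.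
    nearLo : ∀ e → Bounded (λ i → TZ.FullAt c i × P i × block c (z i) ∈ (e ∷ suc e ∷ []))
                     (goodness (suc b) (suc c)) (K * (2 * E))
    nearLo e = bounded-scale K (λ { i (fz , _) → goodness-splitᶻ (suc b) c i fz })
      (bounded-⊆ (λ _ → proj₂) ≤-refl (shrinkᶻ (e ∷ suc e ∷ [])))

    nearHi : ∀ e → Bounded (λ i → TY.FullAt b i × P i × block b (y i) ∈ (e ∷ pred e ∷ []))
                     (goodness (suc b) (suc c)) (K * (2 * E))
    nearHi e = bounded-scale K (λ { i (fy , _) → goodness-splitʸ b (suc c) i fy })
      (bounded-⊆ (λ _ → proj₂) ≤-refl (shrinkʸ (e ∷ pred e ∷ [])))

    choose : ∀ {i Dz Dy} → TY.FullAt b i → TZ.FullAt c i → P i →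
             block c (z i) ∈ Dz ⊎ block b (y i) ∈ Dy →
             (TZ.FullAt c i × P i × block c (z i) ∈ Dz) ⊎ (TY.FullAt b i × P i × block b (y i) ∈ Dy)
    choose fy fz p (inj₁ h) = inj₁ (fz , p , h)
    choose fy fz p (inj₂ h) = inj₂ (fy , p , h)

  good-large : ∀ T {bad good} → bad + good ≡ T * 4 → bad ≤ T → T * 3 ≤ good
  good-large T {bad} {good} eq bad≤T =
    +-cancelˡ-≤ T (T * 3) good (≤-trans (≤-reflexive (trans (sym (*-suc T 3)) (sym eq))) (+-monoˡ-≤ good bad≤T))

  -- The `K ^ (T * 4)` columns have total goodness at most `K ^ (T * 4) * (6 * K) ^ (T * 8)`, and
  -- each counted point has at least `K ^ (T * 6)`. The hypothesis on `6 ^ 8` brings the quotient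
  -- `6 ^ (8 * T) * K ^ (T * 6)` below the bound of `bad-count`.
  good-count : ∀ T → 6 ^ 8 ≤ K * k →
    (∀ i → x i < K ^ (T * 4)) → (∀ i → y i < K ^ (T * 4)) → (∀ i → z i < K ^ (T * 4)) →
    Bounded (λ i → TY.bad (T * 4) i ≤ T × TZ.bad (T * 4) i ≤ T) one ((K ^ T) ^ 7 * k ^ T)
  good-count T 6^8≤ x< y< z< = bounded-count (K ^ (T * 3) * K ^ (T * 3))
    {{m*n≢0 (K ^ (T * 3)) (K ^ (T * 3)) {{m^n≢0 K (T * 3)}} {{m^n≢0 K (T * 3)}}}}
    (λ { i (by , bz) → *-mono-≤
          (^-monoʳ-≤ K (good-large T (TY.bad+good (T * 4) i) by))
          (^-monoʳ-≤ K (good-large T (TZ.bad+good (T * 4) i) bz)) })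
    (bounded-⊆ (λ i _ → (block-top (T * 4) (y< i) , block-top (T * 4) (z< i)) , ∈-upTo⁺ (x< i))
      (≤-reflexive (cong (_* (6 * K) ^ (T * 4 + T * 4)) (length-upTo (K ^ (T * 4)))))
      (bounded-fibres x (upTo (K ^ (T * 4)))
        (λ e → bounded-⊆ (λ { i ((yi , zi) , xi) → xi , yi , zi }) ≤-refl (rectangle-bound (T * 4) (T * 4) e 0 0))))
    (begin
      K ^ (T * 4) * (6 * K) ^ (T * 4 + T * 4)
        ≡⟨ cong₂ _*_ (sym (^-*-assoc K T 4)) six ⟩
      P ^ 4 * ((6 ^ 8) ^ T * P ^ 8)
        ≤⟨ *-monoʳ-≤ (P ^ 4) (*-monoˡ-≤ (P ^ 8) (^-monoˡ-≤ T 6^8≤)) ⟩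
      P ^ 4 * ((K * k) ^ T * P ^ 8)
        ≡⟨ cong (λ t → P ^ 4 * (t * P ^ 8)) (^-distribʳ-* K k T) ⟩
      P ^ 4 * (P * k ^ T * P ^ 8)
        ≡⟨ powers P (k ^ T) ⟩
      P ^ 3 * P ^ 3 * (P ^ 7 * k ^ T)
        ≡⟨ cong (λ t → t * t * (P ^ 7 * k ^ T)) (^-*-assoc K T 3) ⟩
      K ^ (T * 3) * K ^ (T * 3) * (P ^ 7 * k ^ T) ∎)
    where
    open ≤-Reasoning
    P : ℕ
    P = K ^ T
    eight : T * 4 + T * 4 ≡ T * 8
    eight = sym (*-distribˡ-+ T 4 4)
    six : (6 * K) ^ (T * 4 + T * 4) ≡ (6 ^ 8) ^ T * P ^ 8
    six = trans (^-distribʳ-* 6 K (T * 4 + T * 4)) (cong₂ _*_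
      (trans (cong (6 ^_) (trans eight (*-comm T 8))) (sym (^-*-assoc 6 8 T)))
      (trans (cong (K ^_) eight) (sym (^-*-assoc K T 8))))
    powers : ∀ p q → p ^ 4 * (p * q * p ^ 8) ≡ p ^ 3 * p ^ 3 * (p ^ 7 * q)
    powers = solve 2 (λ p q → p :^ 4 :* (p :* q :* p :^ 8) := p :^ 3 :* p :^ 3 :* (p :^ 7 :* q)) refl

  length-bound : .{{_ : NonZero k}} → ∀ T → 6 ^ 8 ≤ K * k →
    (∀ i → x i < K ^ (T * 4)) → (∀ i → y i < K ^ (T * 4)) → (∀ i → z i < K ^ (T * 4)) →
    m ≤ 3 * ((K ^ T) ^ 7 * k ^ T)
  length-bound T 6^8≤ x< y< z< = bounded-all (bounded-⊆ (λ _ p → p) (≤-reflexive (thrice ((K ^ T) ^ 7 * k ^ T)))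
    (bounded-⊎ cases (TY.bad-count T z< y<)
      (bounded-⊎ (λ _ p → p) (TZ.bad-count T y< z<) (good-count T 6^8≤ x< y< z<))))
    where
    thrice : ∀ r → r + (r + r) ≡ 3 * r
    thrice = solve-∀
    cases : ∀ i → ⊤ → T ≤ TY.bad (T * 4) i ⊎ T ≤ TZ.bad (T * 4) i ⊎
                      (TY.bad (T * 4) i ≤ T × TZ.bad (T * 4) i ≤ T)
    cases i _ with ≤-total T (TY.bad (T * 4) i) | ≤-total T (TZ.bad (T * 4) i)
    ... | inj₁ T≤ | _ = inj₁ T≤
    ... | inj₂ _ | inj₁ T≤ = inj₂ (inj₁ T≤)
    ... | inj₂ ≤y | inj₂ ≤z = inj₂ (inj₂ (≤y , ≤z))

-- The quadratic bound and its strict form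

module _ {m n : ℕ} (g h : Fin m → ℕ)
  (g∈ : ∀ i → 1 ≤ g i × g i ≤ n) (h∈ : ∀ i → 1 ≤ h i × h i ≤ n)
  (separated : ∀ i j → i <ᶠ j → g i ≡ g j → h i ≢ h j) where

  index : ∀ u → 1 ≤ u × u ≤ n → Fin n
  index (suc u) (_ , u<n) = fromℕ< u<n

  index-injective : ∀ u v p q → index u p ≡ index v q → u ≡ v
  index-injective (suc u) (suc v) (_ , u<n) (_ , v<n) eq = cong suc (fromℕ<-injective u v u<n v<n eq)

  code : Fin m → Fin (n * n)
  code i = combine (index (g i) (g∈ i)) (index (h i) (h∈ i))

  code-injective : ∀ {i j} → code i ≡ code j → i ≡ j
  code-injective {i} {j} eq with combine-injective _ _ _ _ eq
  ... | eqg , eqh with index-injective _ _ (g∈ i) (g∈ j) eqg | index-injective _ _ (h∈ i) (h∈ j) eqh | <-cmp i j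
  ... | gi≡gj | hi≡hj | tri< i<j _ _ = contradiction hi≡hj (separated i j i<j gi≡gj)
  ... | gi≡gj | hi≡hj | tri≈ _ i≡j _ = i≡j
  ... | gi≡gj | hi≡hj | tri> _ _ j<i = contradiction (sym hi≡hj) (separated j i j<i (sym gi≡gj))

  length-≤ : m ≤ n * n
  length-≤ = injective⇒≤ code-injective

  -- Projection to two coordinates is injective, and `punchOut` removes the missing pair from its
  -- target.
  length-< : ∀ {u v} → 1 ≤ u × u ≤ n → 1 ≤ v × v ≤ n → ¬ (∃[ i ] (g i ≡ u × h i ≡ v)) → m < n * n
  length-< {u} {v} u∈ v∈ missing = avoid (n * n) code code-injective (combine (index u u∈) (index v v∈))
    (λ i eq → let equ , eqv = combine-injective _ _ _ _ eq in
      missing (i , sym (index-injective u (g i) u∈ (g∈ i) equ) , sym (index-injective v (h i) v∈ (h∈ i) eqv)))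
    where
    avoid : ∀ N (f : Fin m → Fin N) → (∀ {i j} → f i ≡ f j → i ≡ j) → ∀ c → (∀ i → c ≢ f i) → m < N
    avoid (suc N) f inj c c≢ = s≤s (injective⇒≤ {f = λ i → punchOut (c≢ i)}
      (λ eq → inj (punchOut-injective (c≢ _) (c≢ _) eq)))

module Small {m n : ℕ} (a : Fin m → Triple) (box : ∀ i → InBox n (a i)) (inc : TwoIncreasing a) where
  open Order a inc

  x∈ : ∀ i → 1 ≤ x i × x i ≤ n
  x∈ i = proj₁ (box i)
  y∈ : ∀ i → 1 ≤ y i × y i ≤ n
  y∈ i = proj₁ (proj₂ (box i))
  z∈ : ∀ i → 1 ≤ z i × z i ≤ n
  z∈ i = proj₂ (proj₂ (box i))

  x-separates : ∀ i j → i <ᶠ j → x i ≡ x j → y i ≢ y j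
  x-separates i j i<j eq = <⇒≢ (proj₁ (same-x i<j eq))

  quadratic : m ≤ n * n
  quadratic = length-≤ x y x∈ y∈ x-separates

  -- If every pair occurred in every coordinate plane, then (1,n) and (n,1) in
  -- the xy-plane would both carry z = n.
  quadratic-strict : 2 ≤ n → m < n * n
  quadratic-strict 2≤n
    with any? (λ i → (x i ≟ 1) ×-dec (y i ≟ n)) | any? (λ i → (x i ≟ 1) ×-dec (z i ≟ n))
       | any? (λ i → (x i ≟ n) ×-dec (y i ≟ 1)) | any? (λ i → (y i ≟ 1) ×-dec (z i ≟ n))
  ... | no missing | _ | _ | _ = length-< x y x∈ y∈ x-separates (≤-refl , <⇒≤ 2≤n) (<⇒≤ 2≤n , ≤-refl) missing
  ... | yes _ | no missing | _ | _ =
    length-< x z x∈ z∈ (λ i j i<j eq → <⇒≢ (proj₂ (same-x i<j eq))) (≤-refl , <⇒≤ 2≤n) (<⇒≤ 2≤n , ≤-refl) missing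
  ... | yes _ | yes _ | no missing | _ = length-< x y x∈ y∈ x-separates (<⇒≤ 2≤n , ≤-refl) (≤-refl , <⇒≤ 2≤n) missing
  ... | yes _ | yes _ | yes _ | no missing =
    length-< y z y∈ z∈ (λ i j i<j eq → <⇒≢ (proj₂ (same-y i<j eq))) (≤-refl , <⇒≤ 2≤n) (<⇒≤ 2≤n , ≤-refl) missing
  ... | yes (i , xi , yi) | yes (i′ , xi′ , zi′) | yes (j , xj , yj) | yes (j′ , yj′ , zj′) =
    ⊥-elim (clash (<-cmp i j))
    where
    above : ∀ {v} → v ≤ n → ∀ {u} → u ≡ n → ¬ (u < v)
    above v≤n refl = ≤⇒≯ v≤n
    -- In the column `x = 1` the point `i` has the largest y and `i′` the largest z. Neither can
    -- precede the other, so they coincide.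
    zi : z i ≡ n
    zi with <-cmp i i′
    ... | tri< i<i′ _ _ = ⊥-elim (above (proj₂ (y∈ i′)) yi (proj₁ (same-x i<i′ (trans xi (sym xi′)))))
    ... | tri≈ _ refl _ = zi′
    ... | tri> _ _ i′<i = ⊥-elim (above (proj₂ (z∈ i)) zi′ (proj₂ (same-x i′<i (trans xi′ (sym xi)))))
    zj : z j ≡ n
    zj with <-cmp j j′
    ... | tri< j<j′ _ _ = ⊥-elim (above (proj₂ (x∈ j′)) xj (proj₁ (same-y j<j′ (trans yj (sym yj′)))))
    ... | tri≈ _ refl _ = zj′
    ... | tri> _ _ j′<j = ⊥-elim (above (proj₂ (z∈ j)) zj′ (proj₂ (same-y j′<j (trans yj′ (sym yj)))))
    clash : _ → ⊥
    clash (tri< i<j _ _) = above (proj₂ (y∈ j)) yi (proj₂ (same-z i<j (trans zi (sym zj))))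
    clash (tri≈ _ i≡j _) = <⇒≢ 2≤n (trans (sym yj) (trans (cong y (sym i≡j)) yi))
    clash (tri> _ _ j<i) = above (proj₂ (x∈ i)) xj (proj₁ (same-z j<i (trans zj (sym zi))))

-- Turning a saved factor into a saved exponent

-- This is `(1 + 1/A) ^ s ≥ 1 + s/A` cleared of denominators.
bernoulli : ∀ A s → A ^ s * (A + s) ≤ A * suc A ^ s
bernoulli A zero = ≤-reflexive (base A)
  where
  base : ∀ A → 1 * (A + 0) ≡ A * 1
  base = solve-∀
bernoulli A (suc s) = begin
  A * A ^ s * (A + suc s)                       ≤⟨ m≤m+n _ (A ^ s * s) ⟩
  A * A ^ s * (A + suc s) + A ^ s * s           ≡⟨ factor A s (A ^ s) ⟩
  suc A * (A ^ s * (A + s))                     ≤⟨ *-monoʳ-≤ (suc A) (bernoulli A s) ⟩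
  suc A * (A * suc A ^ s)                       ≡⟨ *-swap (suc A) A (suc A ^ s) ⟩
  A * (suc A * suc A ^ s)                       ∎
  where
  open ≤-Reasoning
  factor : ∀ A s t → A * t * (A + (1 + s)) + t * s ≡ (1 + A) * (t * (A + s))
  factor = solve-∀

growth : ∀ A .{{_ : NonZero A}} c s → A * c ≤ s → A ^ s * c ≤ suc A ^ s
growth A c s Ac≤s = *-cancelˡ-≤ A (begin
  A * (A ^ s * c)     ≡⟨ *-swap A (A ^ s) c ⟩
  A ^ s * (A * c)     ≤⟨ *-monoʳ-≤ (A ^ s) (≤-trans Ac≤s (m≤n+m s A)) ⟩
  A ^ s * (A + s)     ≤⟨ bernoulli A s ⟩
  A * suc A ^ s       ∎)
  where
  open ≤-Reasoning

-- Saving a single point is enough: by `growth` the ratio of `n * n` to its predecessor, raised to a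
-- power `q` this large, exceeds `n`.
small-n : ∀ {m n q} → 2 ≤ n → m < n * n → n * n * n ≤ q → m ^ q * n ≤ n ^ (2 * q)
small-n {m} {n} {q} 2≤n m<nn nnn≤q with n * n in eq
... | suc A = begin
  m ^ q * n      ≤⟨ *-monoˡ-≤ n (^-monoˡ-≤ q (m<1+n⇒m≤n m<nn)) ⟩
  A ^ q * n      ≤⟨ growth A {{>-nonZero A>0}} n q (≤-trans (*-monoˡ-≤ n (n≤1+n A)) nnn≤q) ⟩
  suc A ^ q      ≡⟨ cong (_^ q) (trans (sym eq) (cong (n *_) (sym (*-identityʳ n)))) ⟩
  (n ^ 2) ^ q    ≡⟨ ^-*-assoc n 2 q ⟩
  n ^ (2 * q)    ∎
  where
  open ≤-Reasoning
  A>0 : 0 < A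
  A>0 = m<1+n⇒m≤n (≤-trans (s≤s (s≤s z≤n)) (subst (4 ≤_) eq (*-mono-≤ 2≤n 2≤n)))

-- Each `u` factors `K / k` pay for one `c`. The lower bounds on `s` and `q` give
-- `u * q + u * s ≤ s * q`, enough for `q + s` copies.
amplify : ∀ {k K c u} → k ≤ K → k ^ u * c ≤ K ^ u → ∀ s q → u + u ≤ s → u + u ≤ q → k ^ (s * q) * (c ^ q * c ^ s) ≤ K ^ (s * q)
amplify {k} {K} {c} {u} k≤K gain s q 2u≤s 2u≤q with m≤n⇒∃[o]m+o≡n enough
  where
  open ≤-Reasoning
  double : ∀ u q s → (u * q + u * s) * 2 ≡ (u + u) * q + (u + u) * s
  double = solve-∀
  undouble : ∀ q s → s * q + q * s ≡ s * q * 2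
  undouble = solve-∀
  enough : u * q + u * s ≤ s * q
  enough = *-cancelʳ-≤ (u * q + u * s) (s * q) 2 (begin
    (u * q + u * s) * 2         ≡⟨ double u q s ⟩
    (u + u) * q + (u + u) * s   ≤⟨ +-mono-≤ (*-monoˡ-≤ q 2u≤s) (*-monoˡ-≤ s 2u≤q) ⟩
    s * q + q * s               ≡⟨ undouble q s ⟩
    s * q * 2                   ∎)
... | d , eq = begin
  k ^ (s * q) * (c ^ q * c ^ s)
    ≡⟨ cong (_* (c ^ q * c ^ s)) (expand k) ⟩
  (k ^ u) ^ q * (k ^ u) ^ s * k ^ d * (c ^ q * c ^ s)
    ≡⟨ regroup ((k ^ u) ^ q) ((k ^ u) ^ s) (k ^ d) (c ^ q) (c ^ s) ⟩
  ((k ^ u) ^ q * c ^ q) * ((k ^ u) ^ s * c ^ s) * k ^ d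
    ≡⟨ cong₂ (λ p r → p * r * k ^ d) (sym (^-distribʳ-* (k ^ u) c q)) (sym (^-distribʳ-* (k ^ u) c s)) ⟩
  (k ^ u * c) ^ q * (k ^ u * c) ^ s * k ^ d
    ≤⟨ *-mono-≤ (*-mono-≤ (^-monoˡ-≤ q gain) (^-monoˡ-≤ s gain)) (^-monoˡ-≤ d k≤K) ⟩
  (K ^ u) ^ q * (K ^ u) ^ s * K ^ d
    ≡⟨ expand K ⟨
  K ^ (s * q) ∎
  where
  open ≤-Reasoning
  expand : ∀ t → t ^ (s * q) ≡ (t ^ u) ^ q * (t ^ u) ^ s * t ^ d
  expand t = trans (cong (t ^_) (sym eq)) (trans (^-distribˡ-+-* t (u * q + u * s) d)
    (cong (_* t ^ d) (trans (^-distribˡ-+-* t (u * q) (u * s))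
      (cong₂ _*_ (sym (^-*-assoc t u q)) (sym (^-*-assoc t u s))))))
  regroup : ∀ a b d e f → a * b * d * (e * f) ≡ (a * e) * (b * f) * d
  regroup = solve-∀

-- In `gain` the 3 pays for the three classes of points in `length-bound`, and `K ^ 8` for rounding
-- `n` up to a power of `K ^ 4`, squared.
module Large (k K u : ℕ) .{{_ : NonZero K}} (k≤K : k ≤ K) (gain : k ^ u * (3 * K ^ 8) ≤ K ^ u) where

  -- The bound on `m` is `3 * P ^ 8` times the `s`-th power of `k / K`. Of the factors saved by
  -- `amplify`, `c ^ q` absorbs the constants and `c ^ s` the extra `n`.
  large-n : ∀ {m n q} t → u + u ≤ suc t → u + u ≤ q →
    m ≤ 3 * ((K ^ suc t) ^ 7 * k ^ suc t) → n ≤ K ^ (suc t * 4) → K ^ (t * 4) ≤ n →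
    m ^ q * n ≤ n ^ (2 * q)
  large-n {m} {n} {q} t 2u≤s 2u≤q m≤ n≤ ≤n = *-cancelʳ-≤ (m ^ q * n) (n ^ (2 * q)) ((K ^ 8) ^ q) {{m^n≢0 (K ^ 8) q {{m^n≢0 K 8}}}} (begin
    m ^ q * n * (K ^ 8) ^ q
      ≤⟨ *-monoˡ-≤ ((K ^ 8) ^ q) (*-mono-≤ (^-monoˡ-≤ q m≤) n≤c^s) ⟩
    (3 * (P ^ 7 * Q)) ^ q * c ^ s * (K ^ 8) ^ q
      ≡⟨ cong (λ r → r * c ^ s * (K ^ 8) ^ q) (trans (^-distribʳ-* 3 (P ^ 7 * Q) q) (cong (3 ^ q *_) (^-distribʳ-* (P ^ 7) Q q))) ⟩
    3 ^ q * ((P ^ 7) ^ q * Q ^ q) * c ^ s * (K ^ 8) ^ q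
      ≡⟨ regroup (3 ^ q) ((P ^ 7) ^ q) (Q ^ q) (c ^ s) ((K ^ 8) ^ q) ⟩
    (P ^ 7) ^ q * (Q ^ q * (3 ^ q * (K ^ 8) ^ q * c ^ s))
      ≡⟨ cong₂ (λ p r → (P ^ 7) ^ q * (p * (r * c ^ s))) (^-*-assoc k s q) (sym (^-distribʳ-* 3 (K ^ 8) q)) ⟩
    (P ^ 7) ^ q * (k ^ (s * q) * (c ^ q * c ^ s))
      ≤⟨ *-monoʳ-≤ ((P ^ 7) ^ q) (amplify {u = u} k≤K gain s q 2u≤s 2u≤q) ⟩
    (P ^ 7) ^ q * K ^ (s * q)
      ≡⟨ cong ((P ^ 7) ^ q *_) (sym (^-*-assoc K s q)) ⟩
    (P ^ 7) ^ q * P ^ q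
      ≡⟨ sym (^-distribʳ-* (P ^ 7) P q) ⟩
    (P ^ 7 * P) ^ q
      ≤⟨ ^-monoˡ-≤ q P^8≤ ⟩
    (n ^ 2 * K ^ 8) ^ q
      ≡⟨ ^-distribʳ-* (n ^ 2) (K ^ 8) q ⟩
    (n ^ 2) ^ q * (K ^ 8) ^ q
      ≡⟨ cong (_* (K ^ 8) ^ q) (^-*-assoc n 2 q) ⟩
    n ^ (2 * q) * (K ^ 8) ^ q ∎)
    where
    open ≤-Reasoning
    s c P Q : ℕ
    s = suc t
    c = 3 * K ^ 8
    P = K ^ s
    Q = k ^ s
    n≤c^s : n ≤ c ^ s
    n≤c^s = begin
      n              ≤⟨ n≤ ⟩
      K ^ (s * 4)    ≡⟨ cong (K ^_) (*-comm s 4) ⟩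
      K ^ (4 * s)    ≡⟨ ^-*-assoc K 4 s ⟨
      (K ^ 4) ^ s    ≤⟨ ^-monoˡ-≤ s (≤-trans (^-monoʳ-≤ K {4} {8} (m≤m+n 4 4)) (m≤n*m (K ^ 8) 3)) ⟩
      c ^ s          ∎
    P^8≤ : P ^ 7 * P ≤ n ^ 2 * K ^ 8
    P^8≤ = begin
      P ^ 7 * P                     ≡⟨ powers K (K ^ t) ⟩
      ((K ^ t) ^ 4) ^ 2 * K ^ 8     ≡⟨ cong (λ r → r ^ 2 * K ^ 8) (^-*-assoc K t 4) ⟩
      (K ^ (t * 4)) ^ 2 * K ^ 8     ≤⟨ *-monoˡ-≤ (K ^ 8) (^-monoˡ-≤ 2 ≤n) ⟩
      n ^ 2 * K ^ 8                 ∎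
      where
      powers : ∀ p r → (p * r) ^ 7 * (p * r) ≡ (r ^ 4) ^ 2 * p ^ 8
      powers = solve 2 (λ p r → (p :* r) :^ 7 :* (p :* r) := (r :^ 4) :^ 2 :* p :^ 8) refl
    regroup : ∀ a b d e f → a * (b * d) * e * f ≡ b * (d * (a * f * e))
    regroup = solve-∀

-- By induction on `n`: the successor either stays in the same interval or is the left end of the
-- next.
scale : ∀ K → 1 < K → ∀ n → 1 ≤ n → ∃[ t ] (K ^ (t * 4) ≤ n × n < K ^ (suc t * 4))
scale K 1<K (suc zero) _ = 0 , ≤-refl , ^-monoʳ-< K 1<K {0} {4} (s≤s z≤n)
scale K 1<K (suc n@(suc _)) _ with scale K 1<K n (s≤s z≤n)
... | t , ≤n , n< with suc n <? K ^ (suc t * 4)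
...   | yes 1+n< = t , m≤n⇒m≤1+n ≤n , 1+n<
...   | no 1+n≮ = suc t , ≮⇒≥ 1+n≮ ,
        ≤-<-trans n< (^-monoʳ-< K 1<K (m<n+m (suc t * 4) {4} (s≤s z≤n)))

-- Choice of constants and conclusion

-- With ε = p/q, the bound `m ≤ n ^ (2 - ε)` is raised to the power `q` and multiplied by `n ^ p`,
-- so that it speaks of natural numbers only.
PowerSaving : Set
PowerSaving = ∃[ p ] ∃[ q ] (0 < p × 0 < q ×
  ((n : ℕ) → 1 ≤ n → (m : ℕ) → (a : Fin m → Triple) →
   ((i : Fin m) → InBox n (a i)) → TwoIncreasing a →
   m ^ q * n ^ p ≤ n ^ (2 * q)))

power-saving-from : ∀ k .{{_ : NonZero k}} u → 6 ^ 8 ≤ suc k * k → k ^ u * (3 * suc k ^ 8) ≤ suc k ^ u →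
  PowerSaving
power-saving-from k u 6^8≤ gain = 1 , q , s≤s z≤n ,
  ≤-trans (>-nonZero⁻¹ (n₀ * n₀ * n₀) {{m*n≢0 (n₀ * n₀) n₀ {{m*n≢0 n₀ n₀}}}}) (m≤m+n _ (u + u)) ,
  λ n 1≤n m a box inc → subst (λ t → m ^ q * t ≤ n ^ (2 * q)) (sym (^-identityʳ n)) (bound n 1≤n m a box inc)
  where
  open Blocks k using (K)
  open Large k K u (n≤1+n k) gain
  -- From `n₀` on, the scale exponent `suc t` is at least `u + u`, as `large-n` requires. In `q` the
  -- cube serves `small-n` below `n₀` and `u + u` serves `large-n`.
  n₀ q : ℕ
  n₀ = K ^ ((u + u) * 4)
  q = n₀ * n₀ * n₀ + (u + u)
  instance
    n₀≢0 : NonZero n₀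
    n₀≢0 = m^n≢0 K ((u + u) * 4)
  bound : (n : ℕ) → 1 ≤ n → (m : ℕ) → (a : Fin m → Triple) →
    ((i : Fin m) → InBox n (a i)) → TwoIncreasing a → m ^ q * n ≤ n ^ (2 * q)
  bound n 1≤n m a box inc with n₀ ≤? n
  ... | yes n₀≤n with scale K (s≤s (>-nonZero⁻¹ k)) n 1≤n
  ...   | t , ≤n , n< = large-n {q = q} t 2u≤1+t (m≤n+m (u + u) (n₀ * n₀ * n₀))
          (Columns.length-bound k a inc (suc t) 6^8≤
            (λ i → ≤-<-trans (proj₂ (x∈ i)) n<) (λ i → ≤-<-trans (proj₂ (y∈ i)) n<) (λ i → ≤-<-trans (proj₂ (z∈ i)) n<))
          (<⇒≤ n<) ≤n
    where
    open Small a box inc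
    2u≤1+t : u + u ≤ suc t
    2u≤1+t with u + u ≤? suc t
    ... | yes le = le
    ... | no nle = contradiction n₀≤n (<⇒≱ (<-≤-trans n< (^-monoʳ-≤ K (*-monoˡ-≤ 4 (<⇒≤ (≰⇒> nle))))))
  -- For `n = 1` every power of `n` is 1 and `m ≤ 1` suffices; the strict bound starts at `n = 2`.
  bound (suc zero) _ m a box inc | no _ = begin
    m ^ q * 1        ≡⟨ *-identityʳ (m ^ q) ⟩
    m ^ q            ≤⟨ ^-monoˡ-≤ q (Small.quadratic a box inc) ⟩
    1 ^ q            ≡⟨ trans (^-zeroˡ q) (sym (^-zeroˡ (2 * q))) ⟩
    1 ^ (2 * q)      ∎
    where open ≤-Reasoning
  bound n@(suc (suc _)) _ m a box inc | no n₀≰n =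
    small-n (s≤s (s≤s z≤n)) (Small.quadratic-strict a box inc (s≤s (s≤s z≤n)))
      (≤-trans (*-mono-≤ (*-mono-≤ n≤n₀ n≤n₀) n≤n₀) (m≤m+n _ (u + u)))
    where
    n≤n₀ = <⇒≤ (≰⇒> n₀≰n)

power-saving : ∀ k .{{_ : NonZero k}} → 6 ^ 8 ≤ suc k * k → PowerSaving
power-saving k 6^8≤ =
  -- The exponent `u` is the smallest that `growth` admits for the constant `3 * suc k ^ 8`.
  power-saving-from k (k * (3 * suc k ^ 8)) 6^8≤ (growth k (3 * suc k ^ 8) (k * (3 * suc k ^ 8)) ≤-refl)

theorem1p13 : ∃[ p ] ∃[ q ] (0 < p × 0 < q ×
    ((n : ℕ) → 1 ≤ n → (m : ℕ) → (a : Fin m → Triple) →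
    ((i : Fin m) → InBox n (a i)) → TwoIncreasing a →
    m ^ q * n ^ p ≤ n ^ (2 * q)))
-- Since 1296 is `6 ^ 4`, it is the least `k` with `6 ^ 8 ≤ suc k * k`.
theorem1p13 = power-saving 1296 (≤ᵇ⇒≤ (6 ^ 8) (1297 * 1296) tt)
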